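{- For every positive integer $t$ there exists an integer $N_t$ such that the following holds. Let $G$ be a finite group (not necessarily abelian, written additively) such that the smallest prime divisor $p$ of $|G|$ satisfies $p>t$. Let $M=[a_1^{\lambda_1},\dots,a_n^{\lambda_n}]$ be a multiset of non-identity elements of $G$, where $a_1,\dots,a_n$ are distinct, $\lambda_i\ge1$, and $n\ge N_t$. Then $M$ is $t$-weakly sequenceable.
   Context: $[a_1^{\lambda_1},\dots,a_n^{\lambda_n}]$ denotes the multiset containing $a_i$ with multiplicity $\lambda_i$; its underlying set is $\{a_1,\dots,a_n\}$. A multiset $M$ of size $m$ is $t$-weakly sequenceable if there is a sequence $(y_1,\dots,y_m)$ in which each element of $M$ appears exactly as many times as its multiplicity, such that the partial sums $s_0=0$, $s_i=y_1+\dots+y_i$ (summed left to right) satisfy $s_i\ne s_j$ whenever $0\le i<j\le m$ and $j-i\le t$. -}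

module Defs where

open import Algebra.Bundles using (Group)
open import Data.Fin.Base using (Fin)
import Data.Fin.Properties as Fin
open import Data.List.Base using (List; filter; foldl; length; tabulate; take)
open import Data.Nat.Base using (ℕ; _≤_; _<_; _∸_)
open import Data.Nat.Divisibility using (_∣_)
open import Data.Nat.ListAction using (sum)
open import Data.Nat.Primality using (Prime)
open import Data.Product.Base using (_×_; ∃-syntax)
open import Function.Bundles using (Inverse)
open import Function.Definitions using (Injective)
open import Function.Properties.Inverse using (Inverse⇒Injection)
open import Level using (Level; _⊔_) renaming (suc to lsuc)
open import Relation.Binary.Definitions using (Decidable)
open import Relation.Binary.PropositionalEquality using (_≡_; setoid)
open import Relation.Nullary.Decidable using (via-injection)

-- The operation is the `_∙_` of the stdlib `Group`, with identity `ε`;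
-- "sums" below are products with respect to it. Finiteness is a
-- bijection (up to `_≈_`) with `Fin order`, so `order` is |G|.
record FiniteGroup (c ℓ : Level) : Set (lsuc (c ⊔ ℓ)) where
  field
    group       : Group c ℓ
    order       : ℕ
    enumeration : Inverse (Group.setoid group) (setoid (Fin order))

  open Group group public

  infix 4 _≟_
  _≟_ : Decidable _≈_
  _≟_ = via-injection (Inverse⇒Injection enumeration) Fin._≟_

IsSmallestPrimeDivisor : ℕ → ℕ → Set
IsSmallestPrimeDivisor p k =
  Prime p × p ∣ k × (∀ q → Prime q → q ∣ k → p ≤ q)

module _ {c ℓ} (G : FiniteGroup c ℓ) where
  open FiniteGroup G

  -- [a₁^λ₁, …, aₙ^λₙ], with `support` = n, `elem i` = aᵢ, `mult i` = λᵢ.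
  record Multiset : Set (c ⊔ ℓ) where
    field
      support  : ℕ
      elem     : Fin support → Carrier
      distinct : Injective _≡_ _≈_ elem
      mult     : Fin support → ℕ
      mult≥1   : ∀ i → 1 ≤ mult i

    size : ℕ
    size = sum (tabulate mult)

module _ {c ℓ} {G : FiniteGroup c ℓ} where
  open FiniteGroup G

  occurrences : Carrier → List Carrier → ℕ
  occurrences x ys = length (filter (_≟ x) ys)

  -- Since the length of `ys` is the size of `M`, the condition on
  -- occurrences leaves no room for elements outside `M`.
  IsOrderingOf : Multiset G → List Carrier → Set
  IsOrderingOf M ys =
    length ys ≡ size × (∀ i → occurrences (elem i) ys ≡ mult i)
    where open Multiset M

  -- sᵢ = y₁ ∙ … ∙ yᵢ, bracketed to the left; only used for i ≤ length ys.
  partialSum : List Carrier → ℕ → Carrier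
  partialSum ys i = foldl _∙_ ε (take i ys)

  WeaklySequenceable : ℕ → Multiset G → Set (c ⊔ ℓ)
  WeaklySequenceable t M =
    ∃[ ys ] IsOrderingOf M ys ×
      (∀ i j → i < j → j ≤ Multiset.size M → j ∸ i ≤ t →
       partialSum ys i ≉ partialSum ys j)

{-# OPTIONS --safe #-}

-- Write each aᵢ as a block aᵢ^λᵢ; only the order of the blocks is chosen. Since
-- every prime factor of |G| exceeds t, x ↦ xᵐ is injective for 1 ≤ m ≤ t, so an
-- equation g xᵐ h = 0 rules out at most one block, and a block can be placed between
-- two valid words by avoiding at most K = (t+1)²t choices. Greedy placement
-- therefore works until K blocks are left, and these are accommodated as follows.
-- Before the greedy phase one lays down K gadgets. A gadget is a stretch
--   … E | y₁ … y_t c | z₁ … z_t …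
-- with two slots such that every block whatsoever fits into one of them: at most K
-- blocks do not fit into the first slot, and c and the zᵢ are chosen (after the yᵢ)
-- so that each of those fits into the second. Windows of length ≤ t do not see across
-- t blocks, so different gadgets do not interact, and each of the last K blocks goes
-- into a gadget of its own.

module Submission where

open import Defs
open import Algebra.Bundles using (Group)
import Algebra.Properties.Group as GroupProperties
import Algebra.Properties.Monoid.Mult as MonoidMult
open import Data.Fin.Base using (Fin; toℕ)
import Data.Fin.Properties as Fin
open import Data.List.Base
  using (List; []; _∷_; [_]; _++_; _∷ʳ_; length; lookup; map; concatMap; filter; foldl; foldr;
         replicate; take; drop; allFin; applyUpTo; upTo)
import Data.List.Membership.DecPropositional as DecMembership
open import Data.List.Membership.Propositional using (_∈_; _∉_; find; lose)
open import Data.List.Membership.Propositional.Properties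
  using (∈-++⁺ˡ; ∈-++⁺ʳ; ∈-++⁻; ∈-∃++; ∈-allFin; ∈-applyUpTo⁺; ∈-applyUpTo⁻; ∈-concatMap⁺;
         ∈-concatMap⁻; ∈-map⁺; ∈-map⁻; ∈-upTo⁺; ∈-upTo⁻)
open import Data.List.Properties
  using (++-assoc; ++-identityʳ; ∷-injectiveˡ; ∷-injectiveʳ; concatMap-++; filter-++; filter-all;
         filter-none; foldl-++; length-++; length-applyUpTo; length-drop; length-map;
         length-replicate; length-tabulate; length-take; length-upTo; map-tabulate; take-[];
         take++drop≡id)
open import Data.List.Relation.Binary.Permutation.Propositional
  using (_↭_; refl; ↭-sym; ↭-trans; ↭⇒↭ₛ; module PermutationReasoning)
open import Data.List.Relation.Binary.Permutation.Propositional.Properties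
  using (↭-length; ∈-resp-↭; ++⁺; ++⁺ˡ; ++⁺ʳ; ++-comm; map⁺; shift)
import Data.List.Relation.Binary.Permutation.Setoid.Properties as ↭ₛ
open import Data.List.Relation.Unary.All using (All; []; _∷_)
open import Data.List.Relation.Unary.All.Properties using (All¬⇒¬Any; ++⁻ˡ; ++⁻ʳ; replicate⁺)
open import Data.List.Relation.Unary.AllPairs using ([]; _∷_)
open import Data.List.Relation.Unary.Any using (here; there; index)
open import Data.List.Relation.Unary.Any.Properties using (lookup-index)
open import Data.List.Relation.Unary.Unique.Propositional using (Unique)
import Data.List.Relation.Unary.Unique.Propositional.Properties as Unique
open import Data.Nat.Base hiding (_⊔_)
open import Data.Nat.Coprimality using (Coprime; coprime-Bézout)
open import Data.Nat.Divisibility using (_∣_; _∤_; divides; hasNonTrivialDivisor; ∣⇒≤; 0∣⇒≡0)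
open import Data.Nat.DivMod using (_%_; _/_; m%n<n; m≡m%n+[m/n]*n)
open import Data.Nat.GCD using (module Bézout)
open import Data.Nat.GeneralisedArithmetic using (fold; fold-+)
open import Data.Nat.Induction using (<-rec)
open import Data.Nat.ListAction using (sum)
open import Data.Nat.ListAction.Properties using (sum-↭)
open import Data.Nat.Primality
  using (Prime; _Rough_; 0-rough; 1-rough; 2-rough; ∤⇒rough-suc; prime⇒nonTrivial; rough∧∣⇒prime)
open import Data.Nat.Properties hiding (_≟_)
open import Data.Product.Base using (∃; ∃₂; ∃-syntax; _×_; _,_)
open import Data.Sum.Base using (_⊎_; inj₁; inj₂)
open import Function.Base using (_∘_; id)
open import Function.Bundles using (Inverse)
open import Level using (Level; _⊔_)
import Relation.Binary.Reasoning.Setoid as SetoidReasoning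
open import Relation.Binary.PropositionalEquality
  using (_≡_; _≢_; refl; sym; trans; cong; cong₂; subst; module ≡-Reasoning)
  renaming (setoid to ≡-setoid)
open import Relation.Nullary.Decidable using (Dec; yes; no; ¬?; decidable-stable)
open import Relation.Nullary.Negation using (¬_; contradiction)
open import Relation.Unary using (Decidable)

private variable
  a ℓ : Level
  A : Set a
  n : ℕ

-- Lists over Fin n

_∈?_ : (x : Fin n) (xs : List (Fin n)) → Dec (x ∈ xs)
_∈?_ = DecMembership._∈?_ Fin._≟_

-- The map sending `i` to its position in `xs` is injective, because looking up that position
-- returns `i`.
covering⇒≤length : (xs : List (Fin n)) → (∀ i → i ∈ xs) → n ≤ length xs
covering⇒≤length xs all∈ = Fin.injective⇒≤ {f = λ i → index (all∈ i)} λ {i} {j} eq →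
  trans (lookup-index (all∈ i)) (trans (cong (lookup xs) eq) (sym (lookup-index (all∈ j))))

fresh : (xs : List (Fin n)) → length xs < n → ∃ (_∉ xs)
fresh xs short with Fin.any? (λ i → ¬? (i ∈? xs))
... | yes i∉xs = i∉xs
... | no  none = contradiction
  (covering⇒≤length xs λ i → decidable-stable (i ∈? xs) λ i∉xs → none (i , i∉xs))
  (<⇒≱ short)

completion : {xs : List (Fin n)} → Unique xs → ∃ λ ys → xs ++ ys ↭ allFin n
completion [] = allFin _ , refl
completion {xs = x ∷ xs} (x∉xs ∷ unique) with completion unique
... | ys , xs++ys↭all with ∈-++⁻ xs (∈-resp-↭ (↭-sym xs++ys↭all) (∈-allFin x))
...   | inj₁ x∈xs = contradiction x∈xs (All¬⇒¬Any x∉xs)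
...   | inj₂ x∈ys with as , bs , refl ← ∈-∃++ x∈ys =
  as ++ bs ,
  ↭-trans (↭-sym (shift x xs (as ++ bs)))
    (↭-trans (++⁺ˡ xs (↭-sym (shift x as bs))) xs++ys↭all)

unique⇒length≤ : {xs : List (Fin n)} → Unique xs → length xs ≤ n
unique⇒length≤ {n = n} {xs} unique with completion unique
... | ys , xs++ys↭all = begin
  length xs              ≤⟨ m≤m+n _ _ ⟩
  length xs + length ys  ≡⟨ length-++ xs ⟨
  length (xs ++ ys)      ≡⟨ ↭-length xs++ys↭all ⟩
  length (allFin n)      ≡⟨ length-tabulate (λ i → i) ⟩
  n                      ∎
  where open ≤-Reasoning

unique-∷ʳ : {x : A} {xs : List A} → Unique xs → x ∉ xs → Unique (xs ∷ʳ x)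
unique-∷ʳ unique x∉xs = Unique.++⁺ unique ([] ∷ []) λ { (x∈xs , here refl) → x∉xs x∈xs }

-- The exceptions form an explicit list: their bounds add up under conjunction, and `gadget` can
-- treat them one by one.
AllBut : ℕ → (Fin n → Set ℓ) → Set ℓ
AllBut k P = ∃ λ bad → length bad ≤ k × (∀ c → c ∉ bad → P c)

allBut-map : ∀ {p q k} {P : Fin n → Set p} {Q : Fin n → Set q} →
             (∀ c → P c → Q c) → AllBut k P → AllBut k Q
allBut-map P⇒Q (bad , short , good) = bad , short , λ c c∉bad → P⇒Q c (good c c∉bad)

allBut-× : ∀ {p q j k} {P : Fin n → Set p} {Q : Fin n → Set q} →
           AllBut j P → AllBut k Q → AllBut (j + k) (λ c → P c × Q c)
allBut-× {j = j} {k} (bad₁ , short₁ , good₁) (bad₂ , short₂ , good₂) =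
  bad₁ ++ bad₂ ,
  subst (_≤ j + k) (sym (length-++ bad₁)) (+-mono-≤ short₁ short₂) ,
  λ c c∉ → good₁ c (c∉ ∘ ∈-++⁺ˡ) , good₂ c (c∉ ∘ ∈-++⁺ʳ bad₁)

allBut-∀∈ : ∀ {k} {P : A → Fin n → Set ℓ} (xs : List A) →
            (∀ x → x ∈ xs → AllBut k (P x)) →
            AllBut (length xs * k) (λ c → ∀ x → x ∈ xs → P x c)
allBut-∀∈ [] _ = [] , z≤n , λ _ _ _ ()
allBut-∀∈ {P = P} (x ∷ xs) good =
  allBut-map both (allBut-× (good x (here refl)) (allBut-∀∈ xs λ y → good y ∘ there))
  where
  both : ∀ c → P x c × (∀ y → y ∈ xs → P y c) → ∀ y → y ∈ x ∷ xs → P y c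
  both c (Px , _)  y (here refl)  = Px
  both c (_ , Pxs) y (there y∈xs) = Pxs y y∈xs

allBut-∀< : ∀ {j} {P : ℕ → Fin n → Set ℓ} k → (∀ i → i < k → AllBut j (P i)) →
            AllBut (k * j) (λ c → ∀ i → i < k → P i c)
allBut-∀< {j = j} {P} k good =
  subst (λ k′ → AllBut (k′ * j) (λ c → ∀ i → i < k → P i c)) (length-upTo k)
    (allBut-map (λ _ Pc i i<k → Pc i (∈-upTo⁺ i<k))
      (allBut-∀∈ (upTo k) λ i i∈ → good i (∈-upTo⁻ i∈)))

allBut⇒∃ : ∀ {j k} {P : Fin n → Set ℓ} → AllBut j P → j ≤ k →
           (used : List (Fin n)) → k + length used < n → ∃ λ c → c ∉ used × P c
allBut⇒∃ {j = j} {k} (bad , short , good) j≤k used room =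
  let c , c∉ = fresh (bad ++ used) (≤-<-trans bound room)
  in  c , c∉ ∘ ∈-++⁺ʳ bad , good c (c∉ ∘ ∈-++⁺ˡ)
  where
  bound : length (bad ++ used) ≤ k + length used
  bound = subst (_≤ _) (sym (length-++ bad)) (+-monoˡ-≤ (length used) (≤-trans short j≤k))

-- Inserting elements

-- All that the construction has to know of words of blocks. `good-glue` expresses locality: t
-- elements hide what lies on one side of them from the other. `Good` makes sense for lists with
-- repetitions; distinctness is tracked separately by `Unique`.
module Insertion
  {n : ℕ} {ℓ : Level} (t K : ℕ) (Good : List (Fin n) → Set ℓ)
  (good-[]     : Good [])
  (good-[_]    : ∀ b → Good [ b ])
  (good-dropˡ  : ∀ xs {ys} → Good (xs ++ ys) → Good ys)
  (good-glue   : ∀ xs ys zs → t ≤ length ys →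
                 Good (xs ++ ys) → Good (ys ++ zs) → Good (xs ++ ys ++ zs))
  (good-insert : ∀ xs ys → Good xs → Good ys → AllBut K (λ c → Good (xs ++ c ∷ ys)))
  where

  good-append : ∀ xs → Good xs → AllBut K (λ c → Good (xs ∷ʳ c))
  good-append xs good = good-insert xs [] good good-[]

  -- The most elements ruled out at once: those unfit to extend one of 1 + K words.
  margin : ℕ
  margin = (1 + K) * K

  -- Each list rules out at most K continuations, so one new element can be found that continues all
  -- of them at once. The lists may contain elements outside `used`: in `gadget` some contain a `b`
  -- that is only a possible later insertion.
  extend : (xss : List (List (Fin n))) → (∀ xs → xs ∈ xss → Good xs) → length xss ≤ 1 + K →
           ∀ k {used} → Unique used → margin + (length used + k) ≤ n →
           ∃ λ ys → length ys ≡ k × Unique (used ++ ys) × (∀ xs → xs ∈ xss → Good (xs ++ ys))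
  extend xss good few zero {used} unique room =
    [] , refl , subst Unique (sym (++-identityʳ used)) unique ,
    λ xs xs∈ → subst Good (sym (++-identityʳ xs)) (good xs xs∈)
  extend xss good few (suc k) {used} unique room
    with ys , refl , unique′ , good′ ← extend xss good few k unique
           (≤-trans (+-monoʳ-≤ margin (+-monoʳ-≤ (length used) (n≤1+n k))) room)
    with c , c∉ , good″ ← allBut⇒∃
           (allBut-∀∈ xss λ xs xs∈ → good-append (xs ++ ys) (good′ xs xs∈))
           (*-monoˡ-≤ K few) (used ++ ys)
           (subst (_≤ n) (trans (cong (margin +_) (trans (+-suc (length used) (length ys))
                                  (cong suc (sym (length-++ used)))))
                           (+-suc margin _)) room)
    = ys ∷ʳ c
    , trans (length-++ ys) (+-comm (length ys) 1)
    , subst Unique (++-assoc used ys [ c ]) (unique-∷ʳ unique′ c∉)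
    , λ xs xs∈ → subst Good (++-assoc xs ys [ c ]) (good″ xs xs∈)

  length-++-≡ : ∀ (xs ys : List (Fin n)) → length ys ≡ t → length (xs ++ ys) ≡ length xs + t
  length-++-≡ xs _ ∣ys∣ = trans (length-++ xs) (cong (length xs +_) ∣ys∣)

  length-++-∷ʳ-≡ : ∀ (xs ys : List (Fin n)) c → length ys ≡ t →
                   length ((xs ++ ys) ∷ʳ c) + t ≡ length xs + (t + suc t)
  length-++-∷ʳ-≡ xs ys c ∣ys∣ =
    trans (cong (_+ t) (trans (length-++ (xs ++ ys)) (cong (_+ 1) (length-++-≡ xs ys ∣ys∣))))
      (trans (+-assoc (length xs + t) 1 t) (+-assoc (length xs) t (suc t)))

  gadget : ∀ E → Good E → ∀ {used} → Unique used → margin + (length used + (t + suc t)) ≤ n →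
           ∃ λ ys → ∃₂ λ c zs → length ys ≡ t × length zs ≡ t × Good zs ×
             Unique ((used ++ ys) ∷ʳ c ++ zs) ×
             (∀ b → Good (E ++ b ∷ ys ++ c ∷ zs) ⊎ Good (E ++ ys ++ c ∷ b ∷ zs))
  gadget E good {used} unique room
    with ys , ∣ys∣ , unique₁ , good₁ ← extend [ E ] (λ { _ (here refl) → good }) (s≤s z≤n) t unique
           (≤-trans (+-monoʳ-≤ margin (+-monoʳ-≤ (length used) (m≤m+n t (suc t)))) room)
    with E-ys ← good₁ E (here refl)
    with bad , few , good₂ ← good-insert E ys good (good-dropˡ E E-ys)
    -- Besides following `E ++ ys`, `c` has to fit between `E ++ ys` and `[ b ]` for each exception
    -- `b`; this rules out at most K + K * K = `margin` elements.
    with c , c∉ , E-ys-c , E-ys-c-bad ← allBut⇒∃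
           (allBut-× (good-append (E ++ ys) E-ys)
                     (allBut-∀∈ bad λ b _ → good-insert (E ++ ys) [ b ] E-ys good-[ b ]))
           (+-monoʳ-≤ K (*-monoˡ-≤ K few)) (used ++ ys)
           (≤-trans (+-monoʳ-< margin (subst (_< _) (sym (length-++-≡ used ys ∣ys∣))
             (+-monoʳ-< (length used) (m<m+n t z<s)))) room)
    -- The same `zs` continues the list without insertion and, for each exception `b`, the list with
    -- `b` after `c`: at most 1 + K lists.
    with zs , ∣zs∣ , unique₃ , good₃ ← extend
           ((E ++ ys) ∷ʳ c ∷ map (λ b → (E ++ ys) ++ c ∷ [ b ]) bad)
           (λ { _ (here refl) → E-ys-c
              ; _ (there xs∈) → let b , b∈ , eq = ∈-map⁻ _ xs∈
                                in  subst Good (sym eq) (E-ys-c-bad b b∈) })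
           (s≤s (≤-trans (≤-reflexive (length-map _ bad)) few))
           t (unique-∷ʳ unique₁ c∉)
           (subst (λ m → margin + m ≤ n) (sym (length-++-∷ʳ-≡ used ys c ∣ys∣)) room)
    = ys , c , zs , ∣ys∣ , ∣zs∣ , good-dropˡ ((E ++ ys) ∷ʳ c) E-ys-c-zs , unique₃ , both
    where
    E-ys-c-zs = good₃ _ (here refl)
    both : ∀ b → Good (E ++ b ∷ ys ++ c ∷ zs) ⊎ Good (E ++ ys ++ c ∷ b ∷ zs)
    both b with b ∈? bad
    ... | yes b∈ = inj₂ (subst Good
            (trans (++-assoc (E ++ ys) (c ∷ [ b ]) zs) (++-assoc E ys (c ∷ b ∷ zs)))
            (good₃ _ (there (∈-map⁺ _ b∈))))
    -- By the choice of `bad`, `b` fits between `E` and `ys`; the t elements of `ys` hide it from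
    -- `c ∷ zs`.
    ... | no  b∉ = inj₁ (subst Good (++-assoc E [ b ] (ys ++ c ∷ zs))
            (good-glue (E ∷ʳ b) ys (c ∷ zs) (≤-reflexive (sym ∣ys∣))
              (subst Good (sym (++-assoc E [ b ] ys)) (good₂ b b∉))
              (good-dropˡ E (subst Good
                (trans (++-assoc (E ++ ys) [ c ] zs) (++-assoc E ys (c ∷ zs))) E-ys-c-zs))))

  -- s elements are laid out and m more, arbitrary ones, can still be fitted in. The tail
  -- does not change in doing so, and it shields what is appended later from the insertions.
  record Absorbing (m s : ℕ) : Set ℓ where
    field
      front tail : List (Fin n)
      unique     : Unique (front ++ tail)
      size       : length (front ++ tail) ≡ s
      long       : t ≤ length tail
      good       : Good tail
      absorb     : ∀ bs → length bs ≡ m → ∃ λ xs → xs ↭ front ++ bs × Good (xs ++ tail)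

  start : margin + t ≤ n → Absorbing 0 t
  start room
    with ys , ∣ys∣ , unique , good ←
      extend [ [] ] (λ { _ (here refl) → good-[] }) (s≤s z≤n) t [] room
    = record
    { front = [] ; tail = ys ; unique = unique ; size = ∣ys∣ ; long = ≤-reflexive (sym ∣ys∣)
    ; good = good [] (here refl)
    ; absorb = λ { [] _ → [] , refl , good [] (here refl) } }

  ↭-insert : ∀ {xs ys bs ws zs : List (Fin n)} {b} → xs ↭ ys ++ bs → ws ↭ b ∷ zs →
             xs ++ ws ↭ (ys ++ zs) ++ b ∷ bs
  ↭-insert {xs} {ys} {bs} {ws} {zs} {b} xs↭ ws↭ = begin
    xs ++ ws               ↭⟨ ++⁺ xs↭ ws↭ ⟩
    (ys ++ bs) ++ b ∷ zs   ≡⟨ ++-assoc ys bs (b ∷ zs) ⟩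
    ys ++ bs ++ b ∷ zs     ↭⟨ ++⁺ˡ ys (++-comm bs (b ∷ zs)) ⟩
    ys ++ b ∷ zs ++ bs     ↭⟨ ++⁺ˡ ys (shift b zs bs) ⟨
    ys ++ zs ++ b ∷ bs     ≡⟨ ++-assoc ys zs (b ∷ bs) ⟨
    (ys ++ zs) ++ b ∷ bs   ∎
    where open PermutationReasoning

  -- Since `E` has at least t elements, the slot that suits `b` does not depend on what has been
  -- inserted into `xs`.
  good-insert-gadget :
    ∀ xs E ys c zs b → t ≤ length E → Good (xs ++ E) →
    Good (E ++ b ∷ ys ++ c ∷ zs) ⊎ Good (E ++ ys ++ c ∷ b ∷ zs) →
    ∃ λ ws → ws ↭ b ∷ E ++ ys ∷ʳ c × Good ((xs ++ ws) ++ zs)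
  good-insert-gadget xs E ys c zs b long good (inj₁ before) =
    E ++ b ∷ ys ∷ʳ c , shift b E (ys ∷ʳ c) , subst Good assoc′ (good-glue xs E _ long good before)
    where
    open ≡-Reasoning
    assoc′ : xs ++ E ++ b ∷ ys ++ c ∷ zs ≡ (xs ++ E ++ b ∷ ys ∷ʳ c) ++ zs
    assoc′ = begin
      xs ++ E ++ b ∷ ys ++ c ∷ zs      ≡⟨ cong (λ us → xs ++ E ++ b ∷ us) (++-assoc ys [ c ] zs) ⟨
      xs ++ E ++ b ∷ (ys ∷ʳ c) ++ zs   ≡⟨ cong (xs ++_) (++-assoc E (b ∷ ys ∷ʳ c) zs) ⟨
      xs ++ (E ++ b ∷ ys ∷ʳ c) ++ zs   ≡⟨ ++-assoc xs (E ++ b ∷ ys ∷ʳ c) zs ⟨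
      (xs ++ E ++ b ∷ ys ∷ʳ c) ++ zs   ∎
  good-insert-gadget xs E ys c zs b long good (inj₂ after) =
    (E ++ ys ∷ʳ c) ∷ʳ b , ++-comm (E ++ ys ∷ʳ c) [ b ] ,
    subst Good assoc′ (good-glue xs E _ long good after)
    where
    open ≡-Reasoning
    assoc′ : xs ++ E ++ ys ++ c ∷ b ∷ zs ≡ (xs ++ (E ++ ys ∷ʳ c) ∷ʳ b) ++ zs
    assoc′ = begin
      xs ++ E ++ ys ++ c ∷ b ∷ zs        ≡⟨ cong (λ us → xs ++ E ++ us)
                                                   (++-assoc ys [ c ] (b ∷ zs)) ⟨
      xs ++ E ++ (ys ∷ʳ c) ++ b ∷ zs     ≡⟨ cong (xs ++_) (++-assoc E (ys ∷ʳ c) (b ∷ zs)) ⟨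
      xs ++ (E ++ ys ∷ʳ c) ++ b ∷ zs     ≡⟨ cong (xs ++_) (++-assoc (E ++ ys ∷ʳ c) [ b ] zs) ⟨
      xs ++ ((E ++ ys ∷ʳ c) ∷ʳ b) ++ zs  ≡⟨ ++-assoc xs ((E ++ ys ∷ʳ c) ∷ʳ b) zs ⟨
      (xs ++ (E ++ ys ∷ʳ c) ∷ʳ b) ++ zs  ∎

  add-gadget : ∀ {m s} → Absorbing m s → margin + (s + (t + suc t)) ≤ n →
               Absorbing (suc m) (s + (t + suc t))
  add-gadget {m} record { front = xs ; tail = E ; unique = unique ; size = refl ; long = long
                        ; good = good ; absorb = absorb } room =
    let ys , c , zs , ∣ys∣ , ∣zs∣ , good-zs , unique′ , either = gadget E good unique room
    in  add ys c zs ∣ys∣ ∣zs∣ good-zs unique′ either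
    where
    add : ∀ ys c zs → length ys ≡ t → length zs ≡ t → Good zs →
          Unique (((xs ++ E) ++ ys) ∷ʳ c ++ zs) →
          (∀ b → Good (E ++ b ∷ ys ++ c ∷ zs) ⊎ Good (E ++ ys ++ c ∷ b ∷ zs)) →
          Absorbing (suc m) (length (xs ++ E) + (t + suc t))
    add ys c zs ∣ys∣ ∣zs∣ good-zs unique′ either = record
      -- The second slot lies just before `zs`, so only `zs` is out of reach of all insertions; the
      -- old tail passes to the front.
      { front  = xs ++ E ++ ys ∷ʳ c
      ; tail   = zs
      ; unique = subst Unique (sym assoc′) unique′
      ; size   = trans (cong length assoc′) (trans (length-++-≡ (((xs ++ E) ++ ys) ∷ʳ c) zs ∣zs∣)
                   (length-++-∷ʳ-≡ (xs ++ E) ys c ∣ys∣))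
      ; long   = ≤-reflexive (sym ∣zs∣)
      ; good   = good-zs
      -- `b` goes into the new gadget and `bs` into the earlier ones.
      ; absorb = λ { (b ∷ bs) ∣bs∣ →
          let xs′ , xs′↭ , good′  = absorb bs (suc-injective ∣bs∣)
              ws  , ws↭  , good″  = good-insert-gadget xs′ E ys c zs b long good′ (either b)
          in  xs′ ++ ws , ↭-insert xs′↭ ws↭ , good″ }
      }
      where
      assoc′ : (xs ++ E ++ ys ∷ʳ c) ++ zs ≡ ((xs ++ E) ++ ys) ∷ʳ c ++ zs
      assoc′ = cong (_++ zs)
        (trans (sym (++-assoc xs E (ys ∷ʳ c))) (sym (++-assoc (xs ++ E) ys [ c ])))

  add-gadgets : ∀ m → margin + (t + m * (t + suc t)) ≤ n → Absorbing m (t + m * (t + suc t))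
  add-gadgets zero    room rewrite +-identityʳ t = start room
  add-gadgets (suc m) room =
    subst (Absorbing (suc m)) (sym size) (add-gadget (add-gadgets m
      (≤-trans (+-monoʳ-≤ margin (+-monoʳ-≤ t (m≤n+m (m * g) g))) room))
      (subst (λ s → margin + s ≤ n) size room))
    where
    g = t + suc t
    size : t + (g + m * g) ≡ t + m * g + g
    size = trans (cong (t +_) (+-comm g (m * g))) (sym (+-assoc t (m * g) g))

  -- The new element only has to follow the tail, which hides it from all insertions. So K
  -- exclusions have to be allowed for instead of `margin`, and greedy placement can go on until
  -- just K elements remain.
  add-element : ∀ {m s} → Absorbing m s → K + s < n → Absorbing m (suc s)
  add-element {m} record { front = xs ; tail = E ; unique = unique ; size = refl ; long = long
                         ; good = good ; absorb = absorb } room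
    with c , c∉ , good′ ← allBut⇒∃ (good-append E good) ≤-refl (xs ++ E) room
    = record
    { front  = xs
    ; tail   = E ∷ʳ c
    ; unique = subst Unique (++-assoc xs E [ c ]) (unique-∷ʳ unique c∉)
    ; size   = trans (cong length (sym (++-assoc xs E [ c ])))
                 (trans (length-++ (xs ++ E)) (+-comm (length (xs ++ E)) 1))
    ; long   = ≤-trans long (≤-trans (m≤m+n _ 1) (≤-reflexive (sym (length-++ E))))
    ; good   = good′
    ; absorb = λ bs ∣bs∣ → let xs′ , xs′↭ , good″ = absorb bs ∣bs∣ in
                 xs′ , xs′↭ , good-glue xs′ E [ c ] long good″ good′
    }

  add-elements : ∀ r {s} → Absorbing K s → r + (K + s) ≡ n → ∃ λ s′ → Absorbing K s′ × K + s′ ≡ n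
  add-elements zero    absorbing eq = _ , absorbing , eq
  add-elements (suc r) {s} absorbing eq =
    add-elements r (add-element absorbing (≤-trans (s≤s (m≤n+m (K + s) r)) (≤-reflexive eq)))
      (trans (cong (r +_) (+-suc K s)) (trans (+-suc r (K + s)) eq))

  complete : ∀ {s} → Absorbing K s → K + s ≡ n → ∃ λ xs → xs ↭ allFin n × Good xs
  complete {s} record { front = xs ; tail = E ; unique = unique ; size = size ; absorb = absorb }
    K+s≡n =
    let bs , used↭ = completion unique
        xs′ , xs′↭ , good = absorb bs (∣bs∣ bs used↭)
    in  xs′ ++ E , ordering bs used↭ xs′ xs′↭ , good
    where
    ∣bs∣ : ∀ bs → (xs ++ E) ++ bs ↭ allFin n → length bs ≡ K
    ∣bs∣ bs used↭ = +-cancelʳ-≡ s (length bs) K (begin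
      length bs + s                 ≡⟨ +-comm (length bs) s ⟩
      s + length bs                 ≡⟨ cong (_+ length bs) size ⟨
      length (xs ++ E) + length bs  ≡⟨ length-++ (xs ++ E) ⟨
      length ((xs ++ E) ++ bs)      ≡⟨ ↭-length used↭ ⟩
      length (allFin n)             ≡⟨ length-tabulate {n = n} (λ i → i) ⟩
      n                             ≡⟨ K+s≡n ⟨
      K + s                         ∎)
      where open ≡-Reasoning

    ordering : ∀ bs → (xs ++ E) ++ bs ↭ allFin n → ∀ xs′ → xs′ ↭ xs ++ bs → xs′ ++ E ↭ allFin n
    ordering bs used↭ xs′ xs′↭ = begin
      xs′ ++ E          ↭⟨ ++⁺ʳ E xs′↭ ⟩
      (xs ++ bs) ++ E   ≡⟨ ++-assoc xs bs E ⟩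
      xs ++ bs ++ E     ↭⟨ ++⁺ˡ xs (++-comm bs E) ⟩
      xs ++ E ++ bs     ≡⟨ ++-assoc xs E bs ⟨
      (xs ++ E) ++ bs   ↭⟨ used↭ ⟩
      allFin n          ∎
      where open PermutationReasoning

  good-ordering : margin + (t + K * (t + suc t)) ≤ n → ∃ λ xs → xs ↭ allFin n × Good xs
  good-ordering room =
    -- The greedy steps use up what the gadgets and the last K elements leave over; the subtraction
    -- is not truncated because K is at most `margin` = K + K * K.
    let s , absorbing , K+s≡n = add-elements (n ∸ (K + s₀)) (add-gadgets K room)
                                  (m∸n+n≡m (≤-trans (+-monoˡ-≤ s₀ (m≤m+n K (K * K))) room))
    in  complete absorbing K+s≡n
    where
    s₀ : ℕ
    s₀ = t + K * (t + suc t)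

-- Powers in a finite group

least : {P : ℕ → Set ℓ} → Decidable P → ∀ k → P k → ∃ λ d → P d × (∀ {i} → i < d → ¬ P i)
least {P = P} P? = <-rec _ search
  where
  search : ∀ k → (∀ {j} → j < k → P j → ∃ λ d → P d × (∀ {i} → i < d → ¬ P i)) →
           P k → ∃ λ d → P d × (∀ {i} → i < d → ¬ P i)
  search k rec Pk with anyUpTo? P? k
  ... | yes (j , j<k , Pj) = rec j<k Pj
  ... | no  none           = k , Pk , λ i<k Pi → none (_ , i<k , Pi)

-- The iterates of `f` form a free action of the cyclic group of order d, so all orbits have d
-- elements and d divides n. It will be applied to translation by a group element.
module FreeOrbits (f : Fin n → Fin n) (d : ℕ) .{{_ : NonZero d}}
  (periodic : ∀ x → fold x f d ≡ x)
  (free     : ∀ x k → 0 < k → k < d → fold x f k ≢ x)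
  where

  orbit : Fin n → List (Fin n)
  orbit x = applyUpTo (fold x f) d

  fold-*d : ∀ x q → fold x f (q * d) ≡ x
  fold-*d x zero    = refl
  fold-*d x (suc q) = trans (fold-+ x f d)
    (trans (cong (λ y → fold y f d) (fold-*d x q)) (periodic x))

  fold∈orbit : ∀ x k → fold x f k ∈ orbit x
  fold∈orbit x k = subst (_∈ orbit x) (sym reduce) (∈-applyUpTo⁺ (fold x f) (m%n<n k d))
    where
    reduce : fold x f k ≡ fold x f (k % d)
    reduce = trans (cong (fold x f) (m≡m%n+[m/n]*n k d))
               (trans (fold-+ x f (k % d)) (cong (λ y → fold y f (k % d)) (fold-*d x (k / d))))

  -- After i steps, d - i more complete the period: this is how steps of `f` are undone.
  rewind : ∀ x {i} → i < d → fold (fold x f i) f (d ∸ i) ≡ x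
  rewind x {i} i<d = begin
    fold (fold x f i) f (d ∸ i)  ≡⟨ fold-+ x f (d ∸ i) ⟨
    fold x f (d ∸ i + i)         ≡⟨ cong (fold x f) (m∸n+n≡m (<⇒≤ i<d)) ⟩
    fold x f d                   ≡⟨ periodic x ⟩
    x                            ∎
    where open ≡-Reasoning

  -- If `z` is i steps from `x` and j steps from `y`, then d - i further steps lead to `x`, which is
  -- thus d - i + j steps from `y`.
  orbit-meet : ∀ {x y z} → z ∈ orbit x → z ∈ orbit y → x ∈ orbit y
  orbit-meet {x} {y} z∈x z∈y
    with i , i<d , refl ← ∈-applyUpTo⁻ (fold x f) z∈x | j , _ , eq ← ∈-applyUpTo⁻ (fold y f) z∈y =
    subst (_∈ orbit y)
      (trans (fold-+ y f (d ∸ i)) (trans (cong (λ z → fold z f (d ∸ i)) (sym eq)) (rewind x i<d)))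
      (fold∈orbit y (d ∸ i + j))

  orbit-unique : ∀ x → Unique (orbit x)
  orbit-unique x = Unique.applyUpTo⁺₁ (fold x f) d λ {i} {j} i<j j<d eq →
    free x (j ∸ i) (m<n⇒0<n∸m i<j) (≤-<-trans (m∸n≤m j i) j<d) (begin
      fold x f (j ∸ i)
        ≡⟨ rewind (fold x f (j ∸ i)) (<-trans i<j j<d) ⟨
      fold (fold (fold x f (j ∸ i)) f i) f (d ∸ i)
        ≡⟨ cong (λ y → fold y f (d ∸ i)) (fold-+ x f i) ⟨
      fold (fold x f (i + (j ∸ i))) f (d ∸ i)
        ≡⟨ cong (λ k → fold (fold x f k) f (d ∸ i)) (m+[n∸m]≡n (<⇒≤ i<j)) ⟩
      fold (fold x f j) f (d ∸ i)
        ≡⟨ cong (λ y → fold y f (d ∸ i)) eq ⟨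
      fold (fold x f i) f (d ∸ i)
        ≡⟨ rewind x (<-trans i<j j<d) ⟩
      x ∎)
    where open ≡-Reasoning

  orbits : List (Fin n) → List (Fin n)
  orbits = concatMap orbit

  length-orbits : ∀ xs → length (orbits xs) ≡ length xs * d
  length-orbits []       = refl
  length-orbits (x ∷ xs) = trans (length-++ (orbit x))
    (cong₂ _+_ (length-applyUpTo (fold x f) d) (length-orbits xs))

  -- An element becomes a representative only if none of the orbits already listed contains it; by
  -- `orbit-meet` its whole orbit is then disjoint from them.
  transversal : ∀ xs → ∃ λ reps → Unique (orbits reps) × (∀ x → x ∈ xs → x ∈ orbits reps)
  transversal [] = [] , [] , λ _ ()
  transversal (x ∷ xs) with reps , unique , covers ← transversal xs with x ∈? orbits reps
  ... | yes x∈ = reps , unique , λ { _ (here refl) → x∈ ; y (there y∈xs) → covers y y∈xs }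
  ... | no  x∉ = x ∷ reps
    , Unique.++⁺ (orbit-unique x) unique disjoint
    , λ { _ (here refl)   → ∈-++⁺ˡ (fold∈orbit x 0)
        ; y (there y∈xs)  → ∈-++⁺ʳ (orbit x) (covers y y∈xs) }
    where
    disjoint : ∀ {z} → ¬ (z ∈ orbit x × z ∈ orbits reps)
    disjoint (z∈x , z∈reps) with r , r∈ , z∈r ← find (∈-concatMap⁻ orbit {xs = reps} z∈reps) =
      x∉ (∈-concatMap⁺ orbit {xs = reps} (lose r∈ (orbit-meet z∈x z∈r)))

  period∣n : d ∣ n
  period∣n with reps , unique , covers ← transversal (allFin n) =
    divides (length reps) (trans
      (≤-antisym (covering⇒≤length (orbits reps) λ i → covers i (∈-allFin i))
        (unique⇒length≤ unique))
      (length-orbits reps))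

-- Lagrange's theorem for cyclic subgroups and injectivity of multiples

module Lagrange {c ℓ} (G : FiniteGroup c ℓ) where
  open FiniteGroup G hiding (refl; sym; trans; reflexive)
  open Inverse enumeration using (to; from; to-cong; from-cong; strictlyInverseˡ; strictlyInverseʳ)
  open GroupProperties group using (∙-cancelˡ; ∙-cancelʳ)
  open MonoidMult monoid using ()
    renaming (_×_ to _·_; ×-homo-+ to ·-homo-+; ×-assocˡ to ·-assocˡ; ×-congʳ to ·-congʳ;
              ×-congˡ to ·-congˡ)
  open SetoidReasoning (Group.setoid group)
  private module ≈ = Group group

  ·ε≈ε : ∀ k → k · ε ≈ ε
  ·ε≈ε zero    = ≈.refl
  ·ε≈ε (suc k) = ≈.trans (identityˡ (k · ε)) (·ε≈ε k)

  -- The multiples of `x` by 0, ..., `order` are too many to be distinct; the difference of two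
  -- coinciding exponents is positive, hence of the form `suc k`.
  finite-order : ∀ x → ∃ λ k → suc k · x ≈ ε
  finite-order x with Fin.pigeonhole (n<1+n order) (λ i → to (toℕ i · x))
  ... | i , j , i<j , eq = pred k , ≈.trans (·-congˡ suc-pred-k) k·x≈ε
    where
    k = toℕ j ∸ toℕ i
    suc-pred-k : suc (pred k) ≡ k
    suc-pred-k = suc-pred k {{>-nonZero (m<n⇒0<n∸m i<j)}}
    k·x≈ε : k · x ≈ ε
    k·x≈ε = ∙-cancelˡ (toℕ i · x) (k · x) ε (begin
      toℕ i · x ∙ k · x      ≈⟨ ·-homo-+ x (toℕ i) k ⟨
      (toℕ i + k) · x        ≡⟨ cong (_· x) (m+[n∸m]≡n (<⇒≤ i<j)) ⟩
      toℕ j · x              ≈⟨ strictlyInverseʳ (toℕ j · x) ⟨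
      from (to (toℕ j · x))  ≡⟨ cong from eq ⟨
      from (to (toℕ i · x))  ≈⟨ strictlyInverseʳ (toℕ i · x) ⟩
      toℕ i · x              ≈⟨ identityʳ (toℕ i · x) ⟨
      toℕ i · x ∙ ε          ∎)

  fold-translate : ∀ x i k → fold i (λ j → to (x ∙ from j)) k ≡ to (k · x ∙ from i)
  fold-translate x i zero    = sym (trans (to-cong (identityˡ (from i))) (strictlyInverseˡ i))
  fold-translate x i (suc k) = to-cong (begin
    x ∙ from (fold i (λ j → to (x ∙ from j)) k)  ≡⟨ cong (λ j → x ∙ from j) (fold-translate x i k) ⟩
    x ∙ from (to (k · x ∙ from i))               ≈⟨ ∙-congˡ (strictlyInverseʳ (k · x ∙ from i)) ⟩
    x ∙ (k · x ∙ from i)                         ≈⟨ assoc x (k · x) (from i) ⟨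
    suc k · x ∙ from i                           ∎)

  -- Translation by `x`, carried over to `Fin order`, returns every point to itself after `suc k`
  -- steps and, by minimality, no sooner.
  leastExponent∣order : ∀ x k → suc k · x ≈ ε → (∀ {i} → i < k → suc i · x ≉ ε) → suc k ∣ order
  leastExponent∣order x k x^k≈ε minimal = FreeOrbits.period∣n (λ j → to (x ∙ from j)) (suc k)
    (λ i → trans (fold-translate x i (suc k))
             (trans (to-cong (≈.trans (∙-congʳ x^k≈ε) (identityˡ (from i)))) (strictlyInverseˡ i)))
    free
    where
    free : ∀ i j → 0 < j → j < suc k → fold i (λ j → to (x ∙ from j)) j ≢ i
    free i (suc j) _ (s≤s j<k) eq = minimal j<k (∙-cancelʳ (from i) (suc j · x) ε (begin
      suc j · x ∙ from i              ≈⟨ strictlyInverseʳ (suc j · x ∙ from i) ⟨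
      from (to (suc j · x ∙ from i))  ≡⟨ cong from (trans (sym (fold-translate x i (suc j))) eq) ⟩
      from i                          ≈⟨ identityˡ (from i) ⟨
      ε ∙ from i                      ∎))

  order·x≈ε : ∀ x → order · x ≈ ε
  order·x≈ε x
    with k₀ , x^k₀≈ε ← finite-order x
    with k , x^k≈ε , minimal ← least (λ k → suc k · x ≟ ε) k₀ x^k₀≈ε
    with divides q order≡ ← leastExponent∣order x k x^k≈ε minimal
    = begin
    order · x        ≡⟨ cong (_· x) order≡ ⟩
    (q * suc k) · x  ≈⟨ ·-assocˡ x q (suc k) ⟨
    q · (suc k · x)  ≈⟨ ·-congʳ q x^k≈ε ⟩
    q · ε            ≈⟨ ·ε≈ε q ⟩
    ε                ∎

  -- As `order` annihilates every element, Bézout makes `u * m` act on each element as the identity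
  -- or as inversion, so `m · x` determines `x`.
  ·-injective : ∀ m → Coprime m order → ∀ {x y} → m · x ≈ m · y → x ≈ y
  ·-injective m coprime {x} {y} mx≈my with coprime-Bézout coprime
  ... | Bézout.+- u v eq = begin
    x          ≈⟨ undo x ⟨
    u · m · x  ≈⟨ ·-congʳ u mx≈my ⟩
    u · m · y  ≈⟨ undo y ⟩
    y          ∎
    where
    undo : ∀ z → u · m · z ≈ z
    undo z = begin
      u · m · z            ≈⟨ ·-assocˡ z u m ⟩
      (u * m) · z          ≡⟨ cong (_· z) eq ⟨
      z ∙ (v * order) · z  ≈⟨ ∙-congˡ (·-assocˡ z v order) ⟨
      z ∙ v · order · z    ≈⟨ ∙-congˡ (·-congʳ v (order·x≈ε z)) ⟩
      z ∙ v · ε            ≈⟨ ∙-congˡ (·ε≈ε v) ⟩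
      z ∙ ε                ≈⟨ identityʳ z ⟩
      z                    ∎
  ... | Bézout.-+ u v eq = ∙-cancelʳ (u · m · x) x y (begin
    x ∙ u · m · x  ≈⟨ undo x ⟩
    ε              ≈⟨ undo y ⟨
    y ∙ u · m · y  ≈⟨ ∙-congˡ (·-congʳ u mx≈my) ⟨
    y ∙ u · m · x  ∎)
    where
    undo : ∀ z → z ∙ u · m · z ≈ ε
    undo z = begin
      z ∙ u · m · z      ≈⟨ ∙-congˡ (·-assocˡ z u m) ⟩
      (1 + u * m) · z    ≡⟨ cong (_· z) eq ⟩
      (v * order) · z    ≈⟨ ·-assocˡ z v order ⟨
      v · order · z      ≈⟨ ·-congʳ v (order·x≈ε z) ⟩
      v · ε              ≈⟨ ·ε≈ε v ⟩
      ε                  ∎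

-- From the smallest prime divisor to coprimality

largePrimes⇒rough-suc : ∀ {t k} → (∀ p → IsSmallestPrimeDivisor p k → t < p) →
                        ∀ m .{{_ : NonTrivial m}} → m ≤ t → m Rough k → suc m Rough k
largePrimes⇒rough-suc {k = k} large m m≤t m-rough = ∤⇒rough-suc m∤k m-rough
  where
  -- A divisor `m` of an `m`-rough number is prime, and roughness leaves no smaller prime divisor;
  -- so `m` would be the smallest one and exceed t.
  m∤k : m ∤ k
  m∤k m∣k = <⇒≱ (large m (rough∧∣⇒prime m-rough m∣k , m∣k , smallest)) m≤t
    where
    smallest : ∀ q → Prime q → q ∣ k → m ≤ q
    smallest q q-prime q∣k = ≮⇒≥ λ q<m →
      m-rough (hasNonTrivialDivisor {{prime⇒nonTrivial q-prime}} q<m q∣k)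

largePrimes⇒rough : ∀ {t k} → (∀ p → IsSmallestPrimeDivisor p k → t < p) →
                    ∀ m → m ≤ suc t → m Rough k
largePrimes⇒rough large zero             = λ _ → 0-rough
largePrimes⇒rough large (suc zero)       = λ _ → 1-rough
largePrimes⇒rough large (suc (suc zero)) = λ _ → 2-rough
largePrimes⇒rough large (suc (suc (suc m))) (s≤s m+2≤t) =
  largePrimes⇒rough-suc large (suc (suc m)) m+2≤t
    (largePrimes⇒rough large (suc (suc m)) (m≤n⇒m≤1+n m+2≤t))

rough⇒coprime : ∀ {t k} → suc t Rough k → ∀ {m} → 1 ≤ m → m ≤ t → Coprime m k
rough⇒coprime _ 1≤m _ {0} (0∣m , _) = contradiction (sym (0∣⇒≡0 0∣m)) (<⇒≢ 1≤m)
rough⇒coprime _ _   _ {1} _         = refl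
rough⇒coprime r 1≤m m≤t {suc (suc _)} (d∣m , d∣k) = contradiction
  (hasNonTrivialDivisor (s≤s (≤-trans (∣⇒≤ {{>-nonZero 1≤m}} d∣m) m≤t)) d∣k) r

-- Factors of words

Factor Suffix Prefix : List A → List A → Set _
Factor y w = ∃₂ λ x z → w ≡ x ++ y ++ z
Suffix u w = ∃ λ x → w ≡ x ++ u
Prefix v w = ∃ λ z → w ≡ v ++ z

-- Levi's lemma: `e` is what lies between the two cuts of the same word.
++-split : ∀ (p : List A) {q} r {s} → p ++ q ≡ r ++ s →
           (∃ λ e → r ≡ p ++ e × q ≡ e ++ s) ⊎ (∃ λ e → p ≡ r ++ e × s ≡ e ++ q)
++-split []      r       eq  = inj₁ (r , refl , eq)
++-split (x ∷ p) []      eq  = inj₂ (x ∷ p , refl , sym eq)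
++-split (x ∷ p) (y ∷ r) eq with refl ← ∷-injectiveˡ eq with ++-split p r (∷-injectiveʳ eq)
... | inj₁ (e , refl , q≡) = inj₁ (e , refl , q≡)
... | inj₂ (e , refl , s≡) = inj₂ (e , refl , s≡)

prefix-++ : (p : List A) {q v : List A} → Prefix v (p ++ q) →
            Prefix v p ⊎ (∃ λ v′ → v ≡ p ++ v′ × Prefix v′ q)
prefix-++ p {v = v} (z , eq) with ++-split p v eq
... | inj₁ (v′ , v≡ , q≡) = inj₂ (v′ , v≡ , z , q≡)
... | inj₂ (e , p≡ , _)   = inj₁ (e , p≡)

factor-++ : (p : List A) {q y : List A} → Factor y (p ++ q) →
            Factor y p ⊎ Factor y q ⊎ (∃₂ λ u v → Suffix u p × Prefix v q × y ≡ u ++ v)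
factor-++ p {y = y} (x , z , eq) with ++-split p x eq
... | inj₁ (e , _ , q≡) = inj₂ (inj₁ (e , z , q≡))
... | inj₂ (e , p≡ , yz≡) with ++-split y e yz≡
...   | inj₁ (f , refl , _)  = inj₁ (x , f , p≡)
...   | inj₂ (f , y≡ , q≡)   = inj₂ (inj₂ (e , f , (x , p≡) , (z , q≡) , y≡))

prefix⇒factor : {v w : List A} → Prefix v w → Factor v w
prefix⇒factor (z , eq) = [] , z , eq

suffix⇒factor : {u w : List A} → Suffix u w → Factor u w
suffix⇒factor {u = u} (x , eq) = x , [] , trans eq (cong (x ++_) (sym (++-identityʳ u)))

factor-++⁺ˡ : ∀ {y p : List A} q → Factor y p → Factor y (p ++ q)
factor-++⁺ˡ {y = y} q (x , z , refl) =
  x , z ++ q , trans (++-assoc x (y ++ z) q) (cong (x ++_) (++-assoc y z q))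

factor-++⁺ʳ : ∀ p {y q : List A} → Factor y q → Factor y (p ++ q)
factor-++⁺ʳ p {y} (x , z , refl) = p ++ x , z , sym (++-assoc p x (y ++ z))

take-length-++ : ∀ (v : List A) z → take (length v) (v ++ z) ≡ v
take-length-++ []      z = refl
take-length-++ (a ∷ v) z = cong (a ∷_) (take-length-++ v z)

drop-length-++ : ∀ (x : List A) u → drop (length x) (x ++ u) ≡ u
drop-length-++ []      u = refl
drop-length-++ (a ∷ x) u = drop-length-++ x u

-- Together with `suffix⇒drop` this lets the outer parts of a window be determined by their lengths,
-- which leaves t + 1 cases for each.
prefix⇒take : {v w : List A} → Prefix v w → v ≡ take (length v) w
prefix⇒take {v = v} (z , refl) = sym (take-length-++ v z)

suffix⇒drop : {u w : List A} → Suffix u w → u ≡ drop (length w ∸ length u) w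
suffix⇒drop {u = u} (x , refl) = sym (trans
  (cong (λ k → drop k (x ++ u))
    (trans (cong (_∸ length u) (length-++ x)) (m+n∸n≡m (length x) (length u))))
  (drop-length-++ x u))

take-+ : ∀ i k (w : List A) → take (i + k) w ≡ take i w ++ take k (drop i w)
take-+ zero    k w       = refl
take-+ (suc i) k []      = sym (take-[] k)
take-+ (suc i) k (a ∷ w) = cong (a ∷_) (take-+ i k w)

constant⇒replicate : ∀ {a : A} {w} → All (_≡ a) w → w ≡ replicate (length w) a
constant⇒replicate []            = refl
constant⇒replicate (refl ∷ all≡) = cong (_ ∷_) (constant⇒replicate all≡)

factor-replicate : ∀ k {a : A} {w} → Factor w (replicate k a) →
                   w ≡ [] ⊎ (∃ λ m → w ≡ replicate (suc m) a)
factor-replicate k {w = []}        _            = inj₁ refl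
factor-replicate k {w = w@(_ ∷ _)} (x , z , eq) = inj₂ (_ ,
  constant⇒replicate (++⁻ˡ w (++⁻ʳ x (subst (All (_≡ _)) eq (replicate⁺ k refl)))))

-- As the inserted run is nonempty, a factor cannot pass from `p` to `q` without containing a letter
-- of it; hence the positive count `suc m`.
factor-around-replicate :
  ∀ (p : List A) {q y} k {a} → 1 ≤ k → Factor y (p ++ replicate k a ++ q) →
  Factor y p ⊎ Factor y q ⊎
  (∃₂ λ u m → ∃ λ v → Suffix u p × Prefix v q × y ≡ u ++ replicate (suc m) a ++ v)
factor-around-replicate p {q} k 1≤k fac with factor-++ p fac
... | inj₁ in-p = inj₁ in-p
... | inj₂ (inj₁ in-kq) with factor-++ (replicate k _) in-kq
...   | inj₂ (inj₁ in-q) = inj₂ (inj₁ in-q)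
...   | inj₁ in-k with factor-replicate k in-k
...     | inj₁ refl       = inj₁ ([] , p , refl)
...     | inj₂ (m , refl) = inj₂ (inj₂ ([] , m , [] , (p , sym (++-identityʳ p)) , (q , refl) ,
                              sym (++-identityʳ _)))
factor-around-replicate p {q} k 1≤k fac
    | inj₂ (inj₁ in-kq) | inj₂ (inj₂ (r , v , r-suffix , v-prefix , refl))
    with factor-replicate k (suffix⇒factor r-suffix)
... | inj₁ refl       = inj₂ (inj₁ (prefix⇒factor v-prefix))
... | inj₂ (m , refl) = inj₂ (inj₂ ([] , m , v , (p , sym (++-identityʳ p)) , v-prefix , refl))
factor-around-replicate p {q} k 1≤k fac
    | inj₂ (inj₂ (u , w , u-suffix , w-prefix , refl)) with prefix-++ (replicate k _) w-prefix
...   | inj₂ (v , refl , v-prefix) = inj₂ (inj₂ (u , pred k , v , u-suffix , v-prefix ,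
          cong (λ j → u ++ replicate j _ ++ v) (sym (suc-pred k {{>-nonZero 1≤k}}))))
...   | inj₁ in-k with factor-replicate k (prefix⇒factor in-k)
...     | inj₁ refl       = inj₁ (subst (λ y → Factor y p) (sym (++-identityʳ u))
                              (suffix⇒factor u-suffix))
...     | inj₂ (m , refl) = inj₂ (inj₂ (u , m , [] , u-suffix , (q , refl) ,
                              cong (u ++_) (sym (++-identityʳ _))))

-- Words of blocks

-- One factor t+1 for each of the parts of a window before and after the inserted block,
-- and a factor t for the positive number of elements of that block in the window.
insertionBound : ℕ → ℕ
insertionBound t = suc t * (suc t * (t * 1))

module Words {c ℓ} {t : ℕ} (G : FiniteGroup c ℓ)
  (large  : ∀ p → IsSmallestPrimeDivisor p (FiniteGroup.order G) → t < p)
  (M      : Multiset G)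
  (elem≉ε : ∀ i → FiniteGroup._≉_ G (Multiset.elem M i) (FiniteGroup.ε G))
  where

  open FiniteGroup G hiding (refl; sym; trans; reflexive)
  open Multiset M
  open Lagrange G using (·-injective; ·ε≈ε)
  open GroupProperties group using (∙-cancelˡ; ∙-cancelʳ; identityʳ-unique)
  open MonoidMult monoid using () renaming (_×_ to _·_)
  private module ≈ = Group group

  small-·-injective : ∀ {m} → 1 ≤ m → m ≤ t → ∀ {x y} → m · x ≈ m · y → x ≈ y
  small-·-injective {m} 1≤m m≤t =
    ·-injective m (rough⇒coprime (largePrimes⇒rough large (suc t) ≤-refl) 1≤m m≤t)

  prod : List Carrier → Carrier
  prod = foldr _∙_ ε

  prod-++ : ∀ xs ys → prod (xs ++ ys) ≈ prod xs ∙ prod ys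
  prod-++ []       ys = ≈.sym (identityˡ (prod ys))
  prod-++ (x ∷ xs) ys = ≈.trans (∙-congˡ (prod-++ xs ys)) (≈.sym (assoc x (prod xs) (prod ys)))

  prod-replicate : ∀ m x → prod (replicate m x) ≡ m · x
  prod-replicate zero    x = refl
  prod-replicate (suc m) x = cong (x ∙_) (prod-replicate m x)

  -- The letters from i+1 to j have product ε exactly when sᵢ = sⱼ. In this form the condition
  -- concerns factors alone and can be checked locally.
  ZeroFree : List Carrier → Set (c ⊔ ℓ)
  ZeroFree w = ∀ y → Factor y w → 1 ≤ length y → length y ≤ t → prod y ≉ ε

  block : Fin support → List Carrier
  block i = replicate (mult i) (elem i)

  word : List (Fin support) → List Carrier
  word = concatMap block

  -- Blocks are nonempty, so a shield of t blocks has at least t letters.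
  length≤length-word : ∀ xs → length xs ≤ length (word xs)
  length≤length-word []       = z≤n
  length≤length-word (x ∷ xs) = subst (suc (length xs) ≤_) (sym (length-++ (block x)))
    (+-mono-≤ (subst (1 ≤_) (sym (length-replicate (mult x))) (mult≥1 x)) (length≤length-word xs))

  Good : List (Fin support) → Set (c ⊔ ℓ)
  Good xs = ZeroFree (word xs)

  good-[] : Good []
  good-[] [] _ ()
  good-[] (_ ∷ _) ([] , _ , ())
  good-[] (_ ∷ _) (_ ∷ _ , _ , ())

  -- A nonempty window inside one block has product `suc m · elem b`; if this were ε, hence
  -- `suc m · ε`, injectivity would give `elem b ≈ ε`.
  good-[_] : ∀ b → Good [ b ]
  good-[ b ] y fac 1≤y y≤t y≈ε
    with factor-replicate (mult b) (subst (Factor y) (++-identityʳ (block b)) fac)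
  ... | inj₁ refl = contradiction 1≤y λ ()
  ... | inj₂ (m , refl) = elem≉ε b
    (small-·-injective (s≤s z≤n) (subst (_≤ t) (length-replicate (suc m)) y≤t)
      (≈.trans (≈.sym (≈.reflexive (prod-replicate (suc m) (elem b))))
        (≈.trans y≈ε (≈.sym (·ε≈ε (suc m))))))

  good-dropˡ : ∀ xs {ys} → Good (xs ++ ys) → Good ys
  good-dropˡ xs {ys} good y fac = good y
    (subst (Factor y) (sym (concatMap-++ block xs ys)) (factor-++⁺ʳ (word xs) fac))

  -- A window that starts in `p` and contains all of `q` has more than t letters, so every window of
  -- length at most t lies in `p ++ q` or in `q ++ r`.
  zeroFree-glue : ∀ p q r → t ≤ length q → ZeroFree (p ++ q) → ZeroFree (q ++ r) →
                  ZeroFree (p ++ q ++ r)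
  zeroFree-glue p q r long pq qr y fac 1≤y y≤t with factor-++ p fac
  ... | inj₁ in-p = pq y (factor-++⁺ˡ q in-p) 1≤y y≤t
  ... | inj₂ (inj₁ in-qr) = qr y in-qr 1≤y y≤t
  ... | inj₂ (inj₂ (u , w , (x , refl) , w-prefix , refl)) with prefix-++ q w-prefix
  ...   | inj₁ (z , refl) = pq (u ++ w)
          (x , z , trans (++-assoc x u (w ++ z)) (cong (x ++_) (sym (++-assoc u w z)))) 1≤y y≤t
  ...   | inj₂ (v , refl , (z , refl)) = straddling u refl
    where
    straddling : ∀ u′ → u′ ≡ u → prod (u ++ q ++ v) ≉ ε
    straddling [] refl = qr (q ++ v) ([] , z , sym (++-assoc q v z)) 1≤y y≤t
    straddling (b ∷ u′) refl = contradiction y≤t (<⇒≱ (s≤s (begin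
      t                               ≤⟨ long ⟩
      length q                        ≤⟨ m≤m+n (length q) (length v) ⟩
      length q + length v             ≡⟨ length-++ q ⟨
      length (q ++ v)                 ≤⟨ m≤n+m (length (q ++ v)) (length u′) ⟩
      length u′ + length (q ++ v)     ≡⟨ length-++ u′ ⟨
      length (u′ ++ q ++ v)           ∎)))
      where open ≤-Reasoning

  good-glue : ∀ xs ys zs → t ≤ length ys → Good (xs ++ ys) → Good (ys ++ zs) → Good (xs ++ ys ++ zs)
  good-glue xs ys zs long good good′ = subst ZeroFree
    (sym (trans (concatMap-++ block xs (ys ++ zs)) (cong (word xs ++_) (concatMap-++ block ys zs))))
    (zeroFree-glue (word xs) (word ys) (word zs) (≤-trans long (length≤length-word ys))
      (subst ZeroFree (concatMap-++ block xs ys) good)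
      (subst ZeroFree (concatMap-++ block ys zs) good′))

  -- Cancelling `g` and `h` shows that two solutions have the same `suc m`-fold multiple;
  -- injectivity and distinctness of the elements then identify them.
  solution-unique : ∀ g h m → m < t → AllBut 1 (λ c → g ∙ (suc m · elem c ∙ h) ≉ ε)
  solution-unique g h m m<t with Fin.any? (λ c → g ∙ (suc m · elem c ∙ h) ≟ ε)
  ... | no  none = [] , z≤n , λ c _ solves → none (c , solves)
  ... | yes (c₀ , solves₀) = [ c₀ ] , ≤-refl , λ c c∉ solves → c∉ (here (distinct
    (small-·-injective (s≤s z≤n) m<t
      (∙-cancelʳ h _ _ (∙-cancelˡ g _ _ (≈.trans solves (≈.sym solves₀)))))))

  -- A window that meets the inserted run is a suffix of `p`, `suc m` copies of `x` and a prefix of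
  -- `q`. The equations to avoid are indexed by what a window can see, with m < t in place of `k`;
  -- this keeps the bound independent of the multiplicities.
  zeroFree-insert : ∀ p q → ZeroFree p → ZeroFree q → ∀ k x → 1 ≤ k →
    (∀ i → i < suc t → ∀ j → j < suc t → ∀ m → m < t →
      prod (drop (length p ∸ i) p) ∙ (suc m · x ∙ prod (take j q)) ≉ ε) →
    ZeroFree (p ++ replicate k x ++ q)
  zeroFree-insert p q p-free q-free k x 1≤k avoids y fac 1≤y y≤t y≈ε
    with factor-around-replicate p k 1≤k fac
  ... | inj₁ in-p = p-free y in-p 1≤y y≤t y≈ε
  ... | inj₂ (inj₁ in-q) = q-free y in-q 1≤y y≤t y≈ε
  ... | inj₂ (inj₂ (u , m , v , u-suffix , v-prefix , refl)) =
    avoids (length u) (s≤s (m+n≤o⇒m≤o (length u) lengths))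
      (length v) (s≤s (m+n≤o⇒n≤o (suc m) (m+n≤o⇒n≤o (length u) lengths)))
      m (m+n≤o⇒m≤o (suc m) (m+n≤o⇒n≤o (length u) lengths))
      (≈.trans (≈.sym product) y≈ε)
    where
    lengths : length u + (suc m + length v) ≤ t
    lengths = subst (_≤ t)
      (trans (length-++ u) (cong (length u +_)
        (trans (length-++ (replicate (suc m) x))
          (cong (_+ length v) (length-replicate (suc m)))))) y≤t

    open SetoidReasoning (Group.setoid group)
    product : prod (u ++ replicate (suc m) x ++ v) ≈
              prod (drop (length p ∸ length u) p) ∙ (suc m · x ∙ prod (take (length v) q))
    product = begin
      prod (u ++ replicate (suc m) x ++ v)
        ≈⟨ prod-++ u (replicate (suc m) x ++ v) ⟩
      prod u ∙ prod (replicate (suc m) x ++ v)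
        ≈⟨ ∙-congˡ (prod-++ (replicate (suc m) x) v) ⟩
      prod u ∙ (prod (replicate (suc m) x) ∙ prod v)
        ≡⟨ cong₂ _∙_ (cong prod (suffix⇒drop u-suffix))
             (cong₂ _∙_ (prod-replicate (suc m) x) (cong prod (prefix⇒take v-prefix))) ⟩
      prod (drop (length p ∸ length u) p) ∙ (suc m · x ∙ prod (take (length v) q)) ∎

  good-insert : ∀ xs ys → Good xs → Good ys → AllBut (insertionBound t) (λ c → Good (xs ++ c ∷ ys))
  good-insert xs ys xs-good ys-good = allBut-map
    (λ c avoids → subst ZeroFree (sym (concatMap-++ block xs (c ∷ ys)))
      (zeroFree-insert (word xs) (word ys) xs-good ys-good (mult c) (elem c) (mult≥1 c) avoids))
    (allBut-∀< (suc t) λ i _ → allBut-∀< (suc t) λ j _ → allBut-∀< t λ m m<t →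
      solution-unique (prod (drop (length (word xs) ∸ i) (word xs)))
                      (prod (take j (word ys))) m m<t)

  -- Multiplicities and partial sums of a word

  length-word : ∀ xs → length (word xs) ≡ sum (map mult xs)
  length-word []       = refl
  length-word (x ∷ xs) = trans (length-++ (block x))
    (cong₂ _+_ (length-replicate (mult x)) (length-word xs))

  occ : Carrier → List Carrier → ℕ
  occ = occurrences {G = G}

  occ-++ : ∀ x ys zs → occ x (ys ++ zs) ≡ occ x ys + occ x zs
  occ-++ x ys zs =
    trans (cong length (filter-++ (_≟ x) ys zs)) (length-++ (filter (_≟ x) ys))

  occ-block : ∀ i → occ (elem i) (block i) ≡ mult i
  occ-block i = trans (cong length (filter-all (_≟ elem i) (replicate⁺ (mult i) ≈.refl)))
    (length-replicate (mult i))

  occ-other-block : ∀ {i j} → i ≢ j → occ (elem i) (block j) ≡ 0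
  occ-other-block {i} {j} i≢j =
    cong length (filter-none (_≟ elem i) (replicate⁺ (mult j) λ eq → i≢j (sym (distinct eq))))

  occ-∉ : ∀ {i} xs → i ∉ xs → occ (elem i) (word xs) ≡ 0
  occ-∉ []       _  = refl
  occ-∉ (x ∷ xs) i∉ = trans (occ-++ (elem _) (block x) (word xs))
    (cong₂ _+_ (occ-other-block (i∉ ∘ here)) (occ-∉ xs (i∉ ∘ there)))

  occ-∈ : ∀ {i xs} → Unique xs → i ∈ xs → occ (elem i) (word xs) ≡ mult i
  occ-∈ {i} {x ∷ xs} (x∉xs ∷ _) (here refl) =
    trans (occ-++ (elem x) (block x) (word xs)) (trans
      (cong₂ _+_ (occ-block x) (occ-∉ xs (All¬⇒¬Any x∉xs))) (+-identityʳ (mult x)))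
  occ-∈ {i} {x ∷ xs} (x∉xs ∷ unique) (there i∈xs) =
    trans (occ-++ (elem i) (block x) (word xs)) (cong₂ _+_
      (occ-other-block λ { refl → All¬⇒¬Any x∉xs i∈xs }) (occ-∈ unique i∈xs))

  word-isOrdering : ∀ {xs} → xs ↭ allFin support → IsOrderingOf {G = G} M (word xs)
  word-isOrdering {xs} xs↭ =
    trans (length-word xs) (trans (sum-↭ (map⁺ mult xs↭)) (cong sum (map-tabulate id mult))) ,
    λ i → occ-∈
      (↭ₛ.Unique-resp-↭ (≡-setoid (Fin support)) (↭⇒↭ₛ (↭-sym xs↭)) (Unique.allFin⁺ support))
      (∈-resp-↭ (↭-sym xs↭) (∈-allFin i))

  foldl≈∙prod : ∀ x ys → foldl _∙_ x ys ≈ x ∙ prod ys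
  foldl≈∙prod x []       = ≈.sym (identityʳ x)
  foldl≈∙prod x (y ∷ ys) = ≈.trans (foldl≈∙prod (x ∙ y) ys) (assoc x y (prod ys))

  sumTo : List Carrier → ℕ → Carrier
  sumTo = partialSum {G = G}

  -- The letters between positions i and j lead from sᵢ to sⱼ, so if these coincided, cancellation
  -- would make the product of the window ε.
  zeroFree⇒partialSums≉ : ∀ {w} → ZeroFree w → ∀ i j → i < j → j ≤ length w → j ∸ i ≤ t →
                          sumTo w i ≉ sumTo w j
  zeroFree⇒partialSums≉ {w} free i j i<j j≤w j-i≤t eq =
    free window (take i w , drop (j ∸ i) (drop i w) , sym split)
      (subst (1 ≤_) (sym length-window) (m<n⇒0<n∸m i<j))
      (subst (_≤ t) (sym length-window) j-i≤t)
      (identityʳ-unique (sumTo w i) (prod window) (begin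
        sumTo w i ∙ prod window           ≈⟨ foldl≈∙prod (sumTo w i) window ⟨
        foldl _∙_ (sumTo w i) window      ≡⟨ foldl-++ _∙_ ε (take i w) window ⟨
        foldl _∙_ ε (take i w ++ window)  ≡⟨ cong (foldl _∙_ ε) (take-+ i (j ∸ i) w) ⟨
        sumTo w (i + (j ∸ i))             ≡⟨ cong (sumTo w) (m+[n∸m]≡n (<⇒≤ i<j)) ⟩
        sumTo w j                         ≈⟨ eq ⟨
        sumTo w i                         ∎))
    where
    open SetoidReasoning (Group.setoid group)
    window : List Carrier
    window = take (j ∸ i) (drop i w)
    length-window : length window ≡ j ∸ i
    length-window = trans (length-take (j ∸ i) (drop i w))
      (m≤n⇒m⊓n≡m (subst (j ∸ i ≤_) (sym (length-drop i w)) (∸-monoˡ-≤ i j≤w)))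
    split : take i w ++ window ++ drop (j ∸ i) (drop i w) ≡ w
    split = trans (cong (take i w ++_) (take++drop≡id (j ∸ i) (drop i w))) (take++drop≡id i w)

  weaklySequenceable : ∀ {xs} → xs ↭ allFin support → Good xs → WeaklySequenceable t M
  weaklySequenceable {xs} xs↭ good =
    let isOrdering@(length≡size , _) = word-isOrdering xs↭
    in  word xs , isOrdering , λ i j i<j j≤size →
          zeroFree⇒partialSums≉ good i j i<j (subst (j ≤_) (sym length≡size) j≤size)

theorem2p5 : ∀ {c ℓ} (t : ℕ) → 1 ≤ t →
    ∃[ N ] (∀ (G : FiniteGroup c ℓ) (let open FiniteGroup G) →
    (∀ p → IsSmallestPrimeDivisor p order → t < p) →
    (M : Multiset G) (let open Multiset M) →
    (∀ i → elem i ≉ ε) →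
    N ≤ support →
    WeaklySequenceable t M)
-- The first summand is `margin`; the second counts the t initial blocks and K gadgets of t + 1 + t
-- blocks each.
theorem2p5 t _ = (1 + K) * K + (t + K * (t + suc t)) , λ G large M elem≉ε N≤support →
  let open Words G large M elem≉ε
      open Insertion t K Good good-[] good-[_] good-dropˡ good-glue good-insert
      xs , xs↭ , good = good-ordering N≤support
  in  weaklySequenceable xs↭ good
  where
  K : ℕ
  K = insertionBound t
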